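{- Let $d_1,d_2$ be positive integers with $d_1$ even and $d_1/d_2$ an odd integer, let $l\ge0$ be an integer, and let $n=d_1+ld_2$. Let $\beta\in\mathcal S_n$ have cycle structure $d_1\cdot d_2^{\,l}$ (one $d_1$-cycle and $l$ cycles of length $d_2$). Then $(\varepsilon,\beta,\beta;(12))\in\mathrm{Par}(n)$ if and only if $0\le l\le d_1/d_2$.
   Context: A Latin square of order $n$ is an $n\times n$ array with rows, columns and symbols indexed by $[n]$, each symbol occurring once in each row and each column, with triple set $O(L)$. Permutations act on the right; $\varepsilon$ is the identity. A paratopism $(\alpha,\beta,\gamma;(12))$ maps $L$ to $L^\sigma$ with triple set $\{(y\beta,x\alpha,z\gamma):(x,y,z)\in O(L)\}$; it is an autoparatopism of $L$ if $L^\sigma=L$. $\mathrm{Par}(n)$ is the set of paratopisms that are autoparatopisms of at least one Latin square of order $n$.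
   Formalization: When l ≥ 1 it is assumed that d₁ ≠ d₂, so that β has exactly one d₁-cycle; with d₁ = d₂ the claim fails (e.g. d₁ = d₂ = 2, l = 2: addition on ℤ₆ with β = +3). -}

module Defs where

open import Data.Fin using (Fin)
open import Data.Fin.Patterns using (0F; 1F; 2F)
open import Data.Fin.Permutation using (Permutation′; transpose; _⟨$⟩ʳ_)
open import Data.List using (List; []; _∷_; _∷ʳ_; map; length; concat; allFin)
open import Data.List.Relation.Binary.Permutation.Propositional using (_↭_)
open import Data.List.Relation.Unary.All using (All)
open import Data.Nat using (ℕ)
open import Data.Product using (∃!; ∃-syntax; _×_)
open import Data.Vec.Functional using (Vector)
open import Level using (0ℓ)
open import Relation.Binary.PropositionalEquality using (_≡_)
open import Relation.Unary using (Pred; _∈_; _≐_)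

record LatinSquare (n : ℕ) : Set where
  field
    entry  : Fin n → Fin n → Fin n
    row    : ∀ x z → ∃! _≡_ (λ y → entry x y ≡ z)
    column : ∀ y z → ∃! _≡_ (λ x → entry x y ≡ z)

Triple : ℕ → Set
Triple n = Vector (Fin n) 3

O : ∀ {n} → LatinSquare n → Pred (Triple n) 0ℓ
O L t = LatinSquare.entry L (t 0F) (t 1F) ≡ t 2F

-- The permutations act on the right in the source: x α is α ⟨$⟩ʳ x.
record Paratopism (n : ℕ) : Set where
  constructor ⟨_,_,_⨾_⟩
  field
    α β γ : Permutation′ n
    δ     : Permutation′ 3

  component : Fin 3 → Permutation′ n
  component 0F = α
  component 1F = β
  component 2F = γ

[12] : Permutation′ 3
[12] = transpose 0F 1F

-- The triple set of L^σ, for T the triple set of L: the i-th coordinate of a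
-- triple is moved by the i-th component of σ and placed in coordinate i δ.
-- For δ = (12) this sends (x , y , z) to (y β , x α , z γ).
_^_ : ∀ {n} → Pred (Triple n) 0ℓ → Paratopism n → Pred (Triple n) 0ℓ
(T ^ σ) t′ = ∃[ t ] t ∈ T × (∀ i → t′ (δ ⟨$⟩ʳ i) ≡ component i ⟨$⟩ʳ t i)
  where open Paratopism σ

IsAutoparatopism : ∀ {n} → Paratopism n → LatinSquare n → Set
IsAutoparatopism σ L = (O L ^ σ) ≐ O L

Par : (n : ℕ) → Pred (Paratopism n) 0ℓ
Par n σ = ∃[ L ] IsAutoparatopism {n} σ L

-- (x₁ x₂ … x_k) is a cycle of π when π maps x₁, …, x_k to x₂, …, x_k, x₁.
-- Distinctness of the xᵢ is not demanded here; HasCycleStructure enforces it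
-- by listing every point exactly once.
data IsCycle {n} (π : Permutation′ n) : Pred (List (Fin n)) 0ℓ where
  cycle : ∀ {x xs} → map (π ⟨$⟩ʳ_) (x ∷ xs) ≡ xs ∷ʳ x → IsCycle π (x ∷ xs)

HasCycleStructure : ∀ {n} → Permutation′ n → List ℕ → Set
HasCycleStructure {n} π lengths =
  ∃[ cycles ] All (IsCycle π) cycles
            × concat cycles ↭ allFin n
            × map length cycles ↭ lengths

{-# OPTIONS --safe #-}
-- Write d₁ = m d and d₂ = d, with m odd and d = 2h.  The paratopism is an
-- autoparatopism of L exactly when (y β) ∘ x = (x ∘ y) β, and then
-- (x βᵏ) ∘ (y βᵏ) = (x ∘ y) β²ᵏ.
--
-- Necessity.  Suppose x₀ ∘ y = z with y and z on cycles of length d and x₀ on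
-- the d₁-cycle.  Taking k = d gives (x₀ βᵈ) ∘ y = z, so x₀ βᵈ = x₀ and d₁ = d.
-- Hence row x₀ sends the l d points of the short cycles injectively to the
-- d₁ points of the long one.
--
-- Sufficiency.  Label the d₁-cycle by ℤ/d₁ and the short cycles by a < l and
-- ℤ/d, so that β adds 1.  Every integer is uniquely t = k d + w or
-- t = -(k d + w) - 1 with 0 ≤ w < h, and t ↦ -t - 1 preserves k.  Let ψ be the
-- involution that exchanges the long point t with the point t of the short
-- cycle k mod m whenever k mod m < l, and fixes the other long points.  Put
--   i ∘ y = (y β⁻ⁱ) ψ β²ⁱ  for i on the long cycle,
-- let the twist identity dictate (short) ∘ (long), and use addition in
-- ℤ/l × ℤ/d on the short points.  The reflection symmetry of ψ makes the
-- identity hold, the oddness of m makes the short rows injective, and columns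
-- are images of rows.
module Submission where

open import Defs

module TwistedProducts where

  open import Data.Bool using (Bool; true; false; not)
  open import Data.Empty using (⊥)
  open import Data.Fin as Fin using (Fin; zero; suc; toℕ; fromℕ<; punchOut; combine; remQuot)
  open import Data.Fin.Patterns using (0F; 1F; 2F)
  open import Data.Fin.Permutation using (Permutation′; id; _⟨$⟩ʳ_; _⟨$⟩ˡ_; inverseʳ)
  open import Data.Fin.Properties using (toℕ-fromℕ<; toℕ<n; toℕ-injective; fromℕ<-injective; nonZeroIndex; any?; punchOut-injective; injective⇒≤; combine-remQuot)
  open import Data.Integer using (ℤ; +_; -_; _+_; _-_; _*_; 0ℤ; 1ℤ; _/ℕ_; _%ℕ_; ∣_∣)
  open import Data.Integer.Divisibility.Signed using (_∣_; divides; ∣⇒∣ᵤ; ∣ᵤ⇒∣; ∣m∣n⇒∣m+n; ∣m⇒∣-m; ∣-trans)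
  open import Data.Integer.DivMod using (n%ℕd<d; a≡a%ℕn+[a/ℕn]*n)
  import Data.Integer.Properties as ℤ
  open import Data.Integer.Tactic.RingSolver using (solve-∀)
  open import Data.List using (List; []; _∷_; _++_; _∷ʳ_; map; concat; length; lookup; replicate; allFin)
  open import Data.List.Membership.Propositional using (_∈_)
  open import Data.List.Membership.Propositional.Properties using (∈-lookup; ∈-allFin; ∈-concat⁻; ∈-concat⁺′)
  open import Data.List.Relation.Binary.Permutation.Propositional as ↭ using (_↭_; ↭-sym; ↭-trans; ↭⇒↭ₛ)
  open import Data.List.Relation.Binary.Permutation.Propositional.Properties using (↭-map-inv; All-resp-↭; ∈-resp-↭; ++⁺ˡ; shifts)
  open import Data.List.Relation.Binary.Permutation.Setoid.Properties using (Unique-resp-↭)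
  open import Data.List.Relation.Unary.All as All using (All; []; _∷_)
  open import Data.List.Relation.Unary.All.Properties using (++⁻ˡ; ++⁻ʳ)
  open import Data.List.Relation.Unary.AllPairs using ([]; _∷_)
  open import Data.List.Relation.Unary.Any as Any using (here; there)
  open import Data.List.Relation.Unary.Any.Properties using (lookup-index)
  open import Data.List.Relation.Unary.Unique.Propositional using (Unique)
  open import Data.List.Relation.Unary.Unique.Propositional.Properties using (allFin⁺)
  open import Data.Nat as ℕ using (ℕ; zero; suc; NonZero; _<_; _≤_; s≤s; z≤n; _<?_)
  import Data.Nat.Divisibility as ℕ
  import Data.Nat.DivMod as ℕ
  import Data.Nat.Properties as ℕ
  open import Data.Nat.Primality using (euclidsLemma; prime[2])
  open import Data.Product using (_×_; _,_; proj₁; proj₂; ∃-syntax)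
  open import Data.Sum using (inj₁; inj₂)
  open import Function using (_∘_; Injective)
  open import Function.Bundles using (Injection)
  open import Function.Properties.Inverse using (↔⇒↣)
  open import Relation.Binary.PropositionalEquality using (_≡_; _≢_; refl; sym; trans; cong; cong₂; subst; setoid; module ≡-Reasoning)
  open import Relation.Nullary using (¬_; yes; no; contradiction)
  open import Relation.Unary using (_⊆_)

  -- Congruence of integers modulo `n`.

  infix 4 _≈_[mod_]

  -- A record, so that i and j can be inferred from a proof of congruence.
  record _≈_[mod_] (i j : ℤ) (n : ℕ) : Set where
    constructor mod
    field n∣i-j : + n ∣ i - j

  ≈-reflexive : ∀ {n i j} → i ≡ j → i ≈ j [mod n ]
  ≈-reflexive {n} {i} refl = mod (divides 0ℤ (ℤ.+-inverseʳ i))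

  ≈-sym : ∀ {n i j} → i ≈ j [mod n ] → j ≈ i [mod n ]
  ≈-sym {n} {i} {j} (mod p) = mod (subst (+ n ∣_) (identity i j) (∣m⇒∣-m p))
    where
    identity : ∀ i j → - (i - j) ≡ j - i
    identity = solve-∀

  ≈-trans : ∀ {n i j k} → i ≈ j [mod n ] → j ≈ k [mod n ] → i ≈ k [mod n ]
  ≈-trans {n} {i} {j} {k} (mod p) (mod q) = mod (subst (+ n ∣_) (identity i j k) (∣m∣n⇒∣m+n p q))
    where
    identity : ∀ i j k → (i - j) + (j - k) ≡ i - k
    identity = solve-∀

  ≈-+ : ∀ {n i j i′ j′} → i ≈ j [mod n ] → i′ ≈ j′ [mod n ] → i + i′ ≈ j + j′ [mod n ]
  ≈-+ {n} {i} {j} {i′} {j′} (mod p) (mod q) = mod (subst (+ n ∣_) (identity i j i′ j′) (∣m∣n⇒∣m+n p q))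
    where
    identity : ∀ i j i′ j′ → (i - j) + (i′ - j′) ≡ (i + i′) - (j + j′)
    identity = solve-∀

  ≈-neg : ∀ {n i j} → i ≈ j [mod n ] → - i ≈ - j [mod n ]
  ≈-neg {n} {i} {j} (mod p) = mod (subst (+ n ∣_) (identity i j) (∣m⇒∣-m p))
    where
    identity : ∀ i j → - (i - j) ≡ (- i) - (- j)
    identity = solve-∀

  ≈-cancelˡ : ∀ {n j k} i → i + j ≈ i + k [mod n ] → j ≈ k [mod n ]
  ≈-cancelˡ {n} {j} {k} i (mod p) = mod (subst (+ n ∣_) (identity i j k) p)
    where
    identity : ∀ i j k → (i + j) - (i + k) ≡ j - k
    identity = solve-∀

  ≈-coarsen : ∀ {m n i j} → m ℕ.∣ n → i ≈ j [mod n ] → i ≈ j [mod m ]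
  ≈-coarsen m∣n (mod p) = mod (∣-trans (∣ᵤ⇒∣ m∣n) p)

  +-≈⇒≤ : ∀ {n a b} → a < n → + a ≈ + b [mod n ] → a ≤ b
  +-≈⇒≤ {n} {a} {b} a<n (mod p) with ℕ.≤-total a b
  ... | inj₁ a≤b = a≤b
  ... | inj₂ b≤a = ℕ.m∸n≡0⇒m≤n (n∣⇒≡0 (a ℕ.∸ b) (ℕ.≤-<-trans (ℕ.m∸n≤m a b) a<n) n∣a∸b)
    where
    n∣a∸b : n ℕ.∣ a ℕ.∸ b
    n∣a∸b = ∣⇒∣ᵤ (subst (+ n ∣_) (trans (ℤ.m-n≡m⊖n a b) (ℤ.⊖-≥ b≤a)) p)
    n∣⇒≡0 : ∀ c → c < n → n ℕ.∣ c → c ≡ 0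
    n∣⇒≡0 zero    _   _   = refl
    n∣⇒≡0 (suc c) c<n n∣c = contradiction (ℕ.∣⇒≤ n∣c) (ℕ.<⇒≱ c<n)

  +-≈⇒≡ : ∀ {n a b} → a < n → b < n → + a ≈ + b [mod n ] → a ≡ b
  +-≈⇒≡ a<n b<n p = ℕ.≤-antisym (+-≈⇒≤ a<n p) (+-≈⇒≤ b<n (≈-sym p))

  %-≈ : ∀ i n .{{_ : NonZero n}} → + (i %ℕ n) ≈ i [mod n ]
  %-≈ i n = mod (divides (- (i /ℕ n)) (trans (cong (λ j → + (i %ℕ n) - j) (a≡a%ℕn+[a/ℕn]*n i n))
                                        (identity (+ (i %ℕ n)) (i /ℕ n) (+ n))))
    where
    identity : ∀ r q n → r - (r + q * n) ≡ (- q) * n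
    identity = solve-∀

  ≈⇒%≡ : ∀ {i j} n .{{_ : NonZero n}} → i ≈ j [mod n ] → i %ℕ n ≡ j %ℕ n
  ≈⇒%≡ {i} {j} n p = +-≈⇒≡ (n%ℕd<d i n) (n%ℕd<d j n) (≈-trans (%-≈ i n) (≈-trans p (≈-sym (%-≈ j n))))

  %≡⇒≈ : ∀ {i j} n .{{_ : NonZero n}} → i %ℕ n ≡ j %ℕ n → i ≈ j [mod n ]
  %≡⇒≈ {i} {j} n eq = ≈-trans (≈-sym (%-≈ i n)) (≈-trans (≈-reflexive (cong +_ eq)) (%-≈ j n))

  -- Integer labels of points, halving modulo an odd number, and addition in ℤ/l.

  -- big is the long cycle, small a the a-th short one.  The integer labels are
  -- not unique: Same relates the labels of one and the same point.
  data Point (l : ℕ) : Set where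
    big   : ℤ → Point l
    small : Fin l → ℤ → Point l

  shift : ∀ {l} → ℤ → Point l → Point l
  shift k (big i)     = big (k + i)
  shift k (small a i) = small a (k + i)

  shift-shift : ∀ {l} i j (c : Point l) → shift i (shift j c) ≡ shift (i + j) c
  shift-shift i j (big k)     = cong big (sym (ℤ.+-assoc i j k))
  shift-shift i j (small a k) = cong (small a) (sym (ℤ.+-assoc i j k))

  module _ (D d : ℕ) {l : ℕ} where

    data Same : Point l → Point l → Set where
      big   : ∀ {i j} → i ≈ j [mod D ] → Same (big i) (big j)
      small : ∀ {a b i j} → a ≡ b → i ≈ j [mod d ] → Same (small a i) (small b j)

  -- Euclid's lemma at 2: in `e * 2 = q * m` the factor 2 must lie in the cofactor `q`, as `m` is
  -- odd, and there it cancels.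
  ∣*2⇒∣ : ∀ {m e} → ¬ (2 ℕ.∣ m) → m ℕ.∣ e ℕ.* 2 → m ℕ.∣ e
  ∣*2⇒∣ {m} {e} 2∤m (ℕ.divides q eq) with euclidsLemma q m prime[2] (ℕ.divides e (sym eq))
  ... | inj₂ 2∣m = contradiction 2∣m 2∤m
  ... | inj₁ (ℕ.divides q′ refl) = ℕ.divides q′ (ℕ.*-cancelʳ-≡ e (q′ ℕ.* m) 2
          (trans eq (trans (ℕ.*-assoc q′ 2 m) (trans (cong (q′ ℕ.*_) (ℕ.*-comm 2 m)) (sym (ℕ.*-assoc q′ m 2))))))

  infixl 6 _⊕_
  -- Addition in ℤ/l. Since `l` may be 0, the argument `a` itself supplies the proof that the
  -- modulus is nonzero.
  _⊕_ : ∀ {l} → Fin l → Fin l → Fin l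
  _⊕_ {l} a b = fromℕ< (n%ℕd<d (+ toℕ a + + toℕ b) l {{nonZeroIndex a}})

  ⊕-comm : ∀ {l} (a b : Fin l) → a ⊕ b ≡ b ⊕ a
  ⊕-comm {l} a b = toℕ-injective (trans (toℕ-fromℕ< _) (trans
    (cong (λ i → (i %ℕ l) {{nonZeroIndex a}}) (ℤ.+-comm (+ toℕ a) (+ toℕ b))) (sym (toℕ-fromℕ< _))))

  ⊕-cancelˡ : ∀ {l} (a b c : Fin l) → a ⊕ b ≡ a ⊕ c → b ≡ c
  ⊕-cancelˡ {l} a b c eq = toℕ-injective (+-≈⇒≡ (toℕ<n b) (toℕ<n c) (≈-cancelˡ (+ toℕ a)
    (%≡⇒≈ l {{nonZeroIndex a}} (trans (sym (toℕ-fromℕ< _)) (trans (cong toℕ eq) (toℕ-fromℕ< _))))))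

  -- The signed decomposition of labels and the involution `ψ`.

  module Square (m h l : ℕ) {{_ : NonZero m}} {{_ : NonZero h}} (2∤m : ¬ (2 ℕ.∣ m)) (l≤m : l ≤ m) where

    d D : ℕ
    d = h ℕ.+ h
    D = m ℕ.* d

    instance
      d≢0 : NonZero d
      d≢0 = ℕ.>-nonZero (ℕ.<-≤-trans (ℕ.>-nonZero⁻¹ h) (ℕ.m≤m+n h h))

    d∣D : d ℕ.∣ D
    d∣D = ℕ.divides m refl

    infix 4 _~_
    _~_ : Point l → Point l → Set
    _~_ = Same D d

    ~-reflexive : ∀ {c c′} → c ≡ c′ → c ~ c′
    ~-reflexive {big i}     refl = big (≈-reflexive refl)
    ~-reflexive {small a i} refl = small refl (≈-reflexive refl)

    ~-sym : ∀ {c c′} → c ~ c′ → c′ ~ c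
    ~-sym (big p)     = big (≈-sym p)
    ~-sym (small e p) = small (sym e) (≈-sym p)

    ~-trans : ∀ {c c′ c″} → c ~ c′ → c′ ~ c″ → c ~ c″
    ~-trans (big p)     (big q)     = big (≈-trans p q)
    ~-trans (small e p) (small f q) = small (trans e f) (≈-trans p q)

    shift-cong : ∀ {i j c c′} → i ≈ j [mod D ] → c ~ c′ → shift i c ~ shift j c′
    shift-cong p (big q)     = big (≈-+ p q)
    shift-cong p (small e q) = small e (≈-+ (≈-coarsen d∣D p) q)

    shift-congʳ : ∀ i {c c′} → c ~ c′ → shift i c ~ shift i c′
    shift-congʳ i = shift-cong (≈-reflexive refl)

    shift-cancel : ∀ i {c c′} → shift i c ~ shift i c′ → c ~ c′
    shift-cancel i {big _}     {big _}     (big p)     = big (≈-cancelˡ i p)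
    shift-cancel i {small _ _} {small _ _} (small e p) = small e (≈-cancelˡ i p)

    -- `true` gives the residues 0, ..., h - 1 modulo `d`, and `false` gives h, ..., d - 1. Flipping
    -- the sign is the reflection t ↦ -t - 1.
    signed : Bool → ℤ → ℕ → ℤ
    signed true  k w = k * + d + + w
    signed false k w = - (k * + d + + w) - 1ℤ

    -- Modulo `d` the quotients vanish. Equal signs leave w ≡ w′ with both below `h`; opposite signs
    -- would make `d` divide w + w′ + 1, which lies strictly between 0 and 2h = d.
    signed-unique : ∀ s s′ {k k′ w w′} → w < h → w′ < h →
                    signed s k w ≈ signed s′ k′ w′ [mod d ] → s ≡ s′ × w ≡ w′
    signed-unique true true {k} {k′} {w} {w′} w<h w′<h (mod p) =
      refl , +-≈⇒≡ (ℕ.<-≤-trans w<h (ℕ.m≤m+n h h)) (ℕ.<-≤-trans w′<h (ℕ.m≤m+n h h)) q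
      where
      identity : ∀ k k′ w w′ d → (k * d + w) - (k′ * d + w′) + (k′ - k) * d ≡ w - w′
      identity = solve-∀
      q : + w ≈ + w′ [mod d ]
      q = mod (subst (+ d ∣_) (identity k k′ (+ w) (+ w′) (+ d)) (∣m∣n⇒∣m+n p (divides (k′ - k) refl)))
    signed-unique false false {k} {k′} {w} {w′} w<h w′<h (mod p) =
      refl , proj₂ (signed-unique true true {k′} {k} w<h w′<h q)
      where
      identity : ∀ k k′ w w′ d → - ((- (k * d + w) - 1ℤ) - (- (k′ * d + w′) - 1ℤ)) + (k′ + k′ - k - k) * d
                               ≡ (k′ * d + w) - (k * d + w′)
      identity = solve-∀
      q : signed true k′ w ≈ signed true k w′ [mod d ]
      q = mod (subst (+ d ∣_) (identity k k′ (+ w) (+ w′) (+ d)) 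
            (∣m∣n⇒∣m+n (∣m⇒∣-m p) (divides (k′ + k′ - k - k) refl)))
    signed-unique true false {k} {k′} {w} {w′} w<h w′<h (mod p) =
      contradiction (ℕ.∣⇒≤ d∣) (ℕ.<⇒≱ bound)
      where
      identity : ∀ k k′ w w′ d → (k * d + w) - (- (k′ * d + w′) - 1ℤ) + (- k - k′) * d ≡ 1ℤ + (w + w′)
      identity = solve-∀
      d∣ : d ℕ.∣ suc (w ℕ.+ w′)
      d∣ = ∣⇒∣ᵤ (subst (+ d ∣_) (identity k k′ (+ w) (+ w′) (+ d))
                  (∣m∣n⇒∣m+n p (divides (- k - k′) refl)))
      bound : suc (w ℕ.+ w′) < d
      bound = ℕ.≤-trans (ℕ.≤-reflexive (cong suc (sym (ℕ.+-suc w w′)))) (ℕ.+-mono-≤ w<h w′<h)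
    signed-unique false true {k} {k′} w<h w′<h p
      with () ← proj₁ (signed-unique true false {k′} {k} w′<h w<h (≈-sym p))

    D≡ : + D ≡ + m * + d
    D≡ = ℤ.pos-* m d

    D∣*d⇒m∣ : ∀ i → + D ∣ i * + d → + m ∣ i
    D∣*d⇒m∣ i (divides q eq) = divides q (ℤ.*-cancelʳ-≡ i (q * + m) (+ d)
      (trans eq (trans (cong (q *_) D≡) (sym (ℤ.*-assoc q (+ m) (+ d))))))

    m∣⇒D∣*d : ∀ i → + m ∣ i → + D ∣ i * + d
    m∣⇒D∣*d i (divides q eq) = divides q
      (trans (cong (_* + d) eq) (trans (ℤ.*-assoc q (+ m) (+ d)) (cong (q *_) (sym D≡))))

    -- With sign and remainder fixed, two labels differ by (k - k′) d up to sign, so the label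
    -- modulo `D = m * d` corresponds to `k` modulo `m`. The converse is `signed-cancel`.
    signed-cong : ∀ s {k k′} w → k ≈ k′ [mod m ] → signed s k w ≈ signed s k′ w [mod D ]
    signed-cong true {k} {k′} w (mod p) = mod (subst (+ D ∣_) (identity k k′ (+ w) (+ d)) (m∣⇒D∣*d (k - k′) p))
      where
      identity : ∀ k k′ w d → (k - k′) * d ≡ (k * d + w) - (k′ * d + w)
      identity = solve-∀
    signed-cong false w p = ≈-+ (≈-neg (signed-cong true w p)) (≈-reflexive refl)

    signed-cancel : ∀ s {k k′} w → signed s k w ≈ signed s k′ w [mod D ] → k ≈ k′ [mod m ]
    signed-cancel true {k} {k′} w (mod p) =
      mod (D∣*d⇒m∣ (k - k′) (subst (+ D ∣_) (identity k k′ (+ w) (+ d)) p))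
      where
      identity : ∀ k k′ w d → (k * d + w) - (k′ * d + w) ≡ (k - k′) * d
      identity = solve-∀
    signed-cancel false {k} {k′} w (mod p) =
      mod (D∣*d⇒m∣ (k - k′) (subst (+ D ∣_) (identity k k′ (+ w) (+ d)) (∣m⇒∣-m p)))
      where
      identity : ∀ k k′ w d → - ((- (k * d + w) - 1ℤ) - (- (k′ * d + w) - 1ℤ)) ≡ (k - k′) * d
      identity = solve-∀

    signed-≈ : ∀ s k k′ w → signed s k w ≈ signed s k′ w [mod d ]
    signed-≈ true k k′ w = mod (divides (k - k′) (identity k k′ (+ w) (+ d)))
      where
      identity : ∀ k k′ w d → (k * d + w) - (k′ * d + w) ≡ (k - k′) * d
      identity = solve-∀
    signed-≈ false k k′ w = ≈-+ (≈-neg (signed-≈ true k k′ w)) (≈-reflexive refl)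

    signed-not : ∀ s k w → - signed s k w - 1ℤ ≡ signed (not s) k w
    signed-not true  k w = refl
    signed-not false k w = identity (k * + d + + w)
      where
      identity : ∀ x → - (- x - 1ℤ) - 1ℤ ≡ x
      identity = solve-∀

    record Split (t : ℤ) : Set where
      constructor mkSplit
      field
        side     : Bool
        quot     : ℤ
        rest     : ℕ
        rest<h   : rest < h
        t≡signed : t ≡ signed side quot rest
    open Split

    split : ∀ t → Split t
    split t with t %ℕ d <? h
    ... | yes r<h = mkSplit true (t /ℕ d) (t %ℕ d) r<h
                        (trans (a≡a%ℕn+[a/ℕn]*n t d) (ℤ.+-comm (+ (t %ℕ d)) (t /ℕ d * + d)))
    -- A residue r ≥ h is measured down from `d`: r = d - (w + 1) with w < h, and the minus sign
    -- turns the quotient q into -q - 1.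
    ... | no  r≮h = mkSplit false (- (t /ℕ d) - 1ℤ) (d ℕ.∸ suc r) rest<h′ eq
      where
      r = t %ℕ d
      h≤r : h ≤ r
      h≤r = ℕ.≮⇒≥ r≮h
      r<d : r < d
      r<d = n%ℕd<d t d
      rest<h′ : d ℕ.∸ suc r < h
      rest<h′ = ℕ.+-cancelʳ-< (suc r) (d ℕ.∸ suc r) h
        (subst (ℕ._< h ℕ.+ suc r) (sym (ℕ.m∸n+n≡m r<d)) (ℕ.+-monoʳ-< h (s≤s h≤r)))
      identity : ∀ r q d → r + q * d ≡ - ((- q - 1ℤ) * d + (d - (1ℤ + r))) - 1ℤ
      identity = solve-∀
      eq : t ≡ signed false (- (t /ℕ d) - 1ℤ) (d ℕ.∸ suc r)
      eq = trans (a≡a%ℕn+[a/ℕn]*n t d) (trans (identity (+ r) (t /ℕ d) (+ d))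
             (cong (λ x → - ((- (t /ℕ d) - 1ℤ) * + d + x) - 1ℤ) (trans (ℤ.m-n≡m⊖n d (suc r)) (ℤ.⊖-≥ r<d))))

    -- The number k mod m, unrelated to the rows of a Latin square. If it is below `l`, it names the
    -- short cycle with which `ψ` pairs `t`.
    row : ℤ → ℕ
    row t = quot (split t) %ℕ m

    row-signed : ∀ {t} s k w → w < h → t ≈ signed s k w [mod D ] → row t ≡ k %ℕ m
    row-signed {t} s k w w<h p with split t
    ... | mkSplit s′ k′ w′ w′<h refl with signed-unique s′ s {k′} {k} w′<h w<h (≈-coarsen d∣D p)
    ...   | refl , refl = ≈⇒%≡ m (signed-cancel s w p)

    row-cong : ∀ {t t′} → t ≈ t′ [mod D ] → row t ≡ row t′
    row-cong {t} {t′} p with split t′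
    ... | mkSplit s k w w<h refl = row-signed s k w w<h p

    -- Reflection flips the sign and keeps `k`. The ordinary quotient by `d` lacks this symmetry,
    -- whence the signed form.
    row-reflect : ∀ t → row (- t - 1ℤ) ≡ row t
    row-reflect t with split t
    ... | mkSplit s k w w<h refl = row-signed (not s) k w w<h (≈-reflexive (signed-not s k w))

    -- The long label, unique modulo `D`, that has `row` equal to `a` and is congruent to `t` modulo
    -- `d`. Sign and remainder depend only on `t` modulo `d`, so `θ-cong` yields an equality and not
    -- just a congruence.
    θ : Fin l → ℤ → ℤ
    θ a t = signed (side (split t)) (+ toℕ a) (rest (split t))

    θ-cong : ∀ a {t t′} → t ≈ t′ [mod d ] → θ a t ≡ θ a t′
    θ-cong a {t} {t′} p with split t | split t′
    ... | mkSplit s k w w<h refl | mkSplit s′ k′ w′ w′<h refl with signed-unique s s′ {k} {k′} w<h w′<h p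
    ...   | refl , refl = refl

    θ-≈ : ∀ a t → θ a t ≈ t [mod d ]
    θ-≈ a t with split t
    ... | mkSplit s k w w<h refl = signed-≈ s (+ toℕ a) k w

    row-θ : ∀ a t → row (θ a t) ≡ toℕ a
    row-θ a t with split t
    ... | mkSplit s k w w<h refl =
      trans (row-signed s (+ toℕ a) w w<h (≈-reflexive refl)) (ℕ.m<n⇒m%n≡m (ℕ.<-≤-trans (toℕ<n a) l≤m))

    θ-row : ∀ a t → row t ≡ toℕ a → θ a t ≈ t [mod D ]
    θ-row a t eq with split t
    ... | mkSplit s k w w<h refl = signed-cong s w (subst (λ x → + x ≈ k [mod m ]) eq (%-≈ k m))

    ψ : Point l → Point l
    ψ (big t) with row t <? l
    ... | yes p = small (fromℕ< p) t
    ... | no  _ = big t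
    ψ (small a t) = big (θ a t)

    ψ-swaps : ∀ {t} a → row t ≡ toℕ a → ψ (big t) ≡ small a t
    ψ-swaps {t} a eq with row t <? l
    ... | yes p = cong (λ b → small b t) (toℕ-injective (trans (toℕ-fromℕ< p) eq))
    ... | no ¬p = contradiction (subst (_< l) (sym eq) (toℕ<n a)) ¬p

    ψ-fixes : ∀ {t} → ¬ (row t < l) → ψ (big t) ≡ big t
    ψ-fixes {t} ¬p with row t <? l
    ... | yes p = contradiction p ¬p
    ... | no  _ = refl

    ψ-big-cong : ∀ {t t′} → t ≈ t′ [mod D ] → ψ (big t) ~ ψ (big t′)
    ψ-big-cong {t} {t′} p with row t <? l
    ... | yes r<l = ~-trans (small refl (≈-coarsen d∣D p))
                      (~-reflexive (sym (ψ-swaps (fromℕ< r<l) (trans (sym (row-cong p)) (sym (toℕ-fromℕ< r<l))))))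
    ... | no  r≮l = ~-trans (big p) (~-reflexive (sym (ψ-fixes (λ q → r≮l (subst (_< l) (sym (row-cong p)) q)))))

    ψ-cong : ∀ {c c′} → c ~ c′ → ψ c ~ ψ c′
    ψ-cong (big p)              = ψ-big-cong p
    ψ-cong (small {a} refl p)   = big (≈-reflexive (θ-cong a p))

    ψ-involutive : ∀ c → ψ (ψ c) ~ c
    ψ-involutive (big t) with row t <? l
    ... | yes r<l = big (θ-row (fromℕ< r<l) t (sym (toℕ-fromℕ< r<l)))
    ... | no  r≮l = ~-reflexive (ψ-fixes r≮l)
    ψ-involutive (small a t) = ~-trans (~-reflexive (ψ-swaps a (row-θ a t))) (small refl (θ-≈ a t))

    ψ-injective : ∀ {c c′} → ψ c ~ ψ c′ → c ~ c′
    ψ-injective {c} {c′} p = ~-trans (~-sym (ψ-involutive c)) (~-trans (ψ-cong p) (ψ-involutive c′))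

    -- On long points `ψ` keeps the integer label and may only change the cycle. That choice is
    -- governed by `row`, which reflection preserves, so the two images differ just by the shift
    -- from t to -t - 1.
    ψ-reflect : ∀ t → ψ (big (- t - 1ℤ)) ≡ shift (- (t + t) - 1ℤ) (ψ (big t))
    ψ-reflect t with row t <? l
    ... | yes r<l = trans (ψ-swaps (fromℕ< r<l) (trans (row-reflect t) (sym (toℕ-fromℕ< r<l))))
                          (cong (small _) (identity t))
      where
      identity : ∀ t → - t - 1ℤ ≡ - (t + t) - 1ℤ + t
      identity = solve-∀
    ... | no  r≮l = trans (ψ-fixes (λ q → r≮l (subst (_< l) (row-reflect t) q))) (cong big (identity t))
      where
      identity : ∀ t → - t - 1ℤ ≡ - (t + t) - 1ℤ + t
      identity = solve-∀

    -- If i - j = e d, the doubled congruence says that `m` divides 2e; as `m` is odd, it divides e.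
    halve-≈ : ∀ {i j} → i ≈ j [mod d ] → i + i ≈ j + j [mod D ] → i ≈ j [mod D ]
    halve-≈ {i} {j} (mod (divides e eq)) (mod p) =
      mod (subst (+ D ∣_) (sym eq) (m∣⇒D∣*d e (∣ᵤ⇒∣ (∣*2⇒∣ 2∤m m∣∣e∣*2))))
      where
      identity : ∀ i j → (i + i) - (j + j) ≡ (i - j) + (i - j)
      identity = solve-∀
      double : (i + i) - (j + j) ≡ (e + e) * + d
      double = trans (identity i j) (trans (cong₂ _+_ eq eq) (sym (ℤ.*-distribʳ-+ (+ d) e e)))
      times2 : ∀ e → e + e ≡ e * + 2
      times2 = solve-∀
      m∣∣e∣*2 : m ℕ.∣ ∣ e ∣ ℕ.* 2
      m∣∣e∣*2 = subst (m ℕ.∣_) (trans (cong ∣_∣ (times2 e)) (ℤ.abs-* e (+ 2)))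
                  (∣⇒∣ᵤ (D∣*d⇒m∣ (e + e) (subst (+ D ∣_) double p)))

    -- The product on labels: twist identity and left cancellation.

    infixl 7 _∙_
    -- Row `big 0` is `ψ`; the rule (x βᵏ) ∘ (y βᵏ) = (x ∘ y) β²ᵏ then forces every row `big i`.
    _∙_ : Point l → Point l → Point l
    big i     ∙ y         = shift (i + i) (ψ (shift (- i) y))
    -- The twist identity dictates this value: it is the product of `big i` and `small a (j - 1)`,
    -- shifted by 1.
    small a j ∙ big i     = shift (i + i + 1ℤ) (ψ (small a (j - i - 1ℤ)))
    small a j ∙ small b k = small (a ⊕ b) (j + k)

    -- Needed on the left only: in the twist identity the image of `y` under `β` stands there, and
    -- its chosen label may differ from the shifted label of `y`.
    ∙-congˡ : ∀ y {x x′} → x ~ x′ → x ∙ y ~ x′ ∙ y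
    ∙-congˡ y (big p) = shift-cong (≈-+ p p) (ψ-cong (shift-cong (≈-neg p) (~-reflexive {y} refl)))
    ∙-congˡ (big i) (small refl p) =
      shift-congʳ (i + i + 1ℤ) (ψ-cong (small refl (≈-+ (≈-+ p (≈-reflexive refl)) (≈-reflexive refl))))
    ∙-congˡ (small b k) (small e p) = small (cong (_⊕ b) e) (≈-+ p (≈-reflexive refl))

    -- Long times long is `ψ-reflect` at t = j - i. The mixed cases hold by the choice of short
    -- times long, and short times short by commutativity of addition.
    ∙-twist : ∀ x y → shift 1ℤ y ∙ x ≡ shift 1ℤ (x ∙ y)
    ∙-twist (big i) (big j) = begin
      shift (1ℤ + j + (1ℤ + j)) (ψ (big (- (1ℤ + j) + i)))
        ≡⟨ cong (λ u → shift (1ℤ + j + (1ℤ + j)) (ψ (big u))) (identity₁ i j) ⟩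
      shift (1ℤ + j + (1ℤ + j)) (ψ (big (- t - 1ℤ)))
        ≡⟨ cong (shift _) (ψ-reflect t) ⟩
      shift (1ℤ + j + (1ℤ + j)) (shift (- (t + t) - 1ℤ) (ψ (big t)))
        ≡⟨ shift-shift _ _ (ψ (big t)) ⟩
      shift (1ℤ + j + (1ℤ + j) + (- (t + t) - 1ℤ)) (ψ (big t))
        ≡⟨ cong (λ u → shift u (ψ (big t))) (identity₂ i j) ⟩
      shift (1ℤ + (i + i)) (ψ (big t))
        ≡⟨ shift-shift _ _ (ψ (big t)) ⟨
      shift 1ℤ (shift (i + i) (ψ (big t))) ∎
      where
      open ≡-Reasoning
      t = - i + j
      identity₁ : ∀ i j → - (1ℤ + j) + i ≡ - (- i + j) - 1ℤ
      identity₁ = solve-∀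
      identity₂ : ∀ i j → 1ℤ + j + (1ℤ + j) + (- ((- i + j) + (- i + j)) - 1ℤ) ≡ 1ℤ + (i + i)
      identity₂ = solve-∀
    ∙-twist (small a k) (big j) = cong big (trans
      (cong (λ u → 1ℤ + j + (1ℤ + j) + θ a u) (identity₁ j k)) (identity₂ j _))
      where
      identity₁ : ∀ j k → - (1ℤ + j) + k ≡ k - j - 1ℤ
      identity₁ = solve-∀
      identity₂ : ∀ j x → 1ℤ + j + (1ℤ + j) + x ≡ 1ℤ + (j + j + 1ℤ + x)
      identity₂ = solve-∀
    ∙-twist (big i) (small a k) = cong big (trans
      (cong (λ u → i + i + 1ℤ + θ a u) (identity₁ i k)) (identity₂ i _))
      where
      identity₁ : ∀ i k → 1ℤ + k - i - 1ℤ ≡ - i + k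
      identity₁ = solve-∀
      identity₂ : ∀ i x → i + i + 1ℤ + x ≡ 1ℤ + (i + i + x)
      identity₂ = solve-∀
    ∙-twist (small a j) (small b k) = cong₂ small (⊕-comm b a) (identity j k)
      where
      identity : ∀ j k → 1ℤ + k + j ≡ 1ℤ + (j + k)
      identity = solve-∀

    -- A long row is `ψ` between two shifts. A short row preserves the kind of a point; on short
    -- points it is a translation. On long points the product modulo `d` gives i ≡ i′, which makes
    -- the `θ` values equal; cancelling them leaves 2i ≡ 2i′ modulo `D`, and `halve-≈` applies.
    ∙-cancelˡ : ∀ x {y z} → x ∙ y ~ x ∙ z → y ~ z
    ∙-cancelˡ (big i) p = shift-cancel (- i) (ψ-injective (shift-cancel (i + i) p))
    ∙-cancelˡ (small a j) {small b k} {small c k′} (small e p) = small (⊕-cancelˡ a b c e) (≈-cancelˡ j p)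
    ∙-cancelˡ (small a j) {big i} {big i′} (big p) = big (halve-≈ i≈i′ 2i≈2i′)
      where
      s s′ : ℤ
      s  = j - i - 1ℤ
      s′ = j - i′ - 1ℤ
      identity : ∀ i j → i + i + 1ℤ + (j - i - 1ℤ) ≡ j + i
      identity = solve-∀
      -- Modulo `d` the map `θ a` is the identity, so even this product becomes addition of labels.
      reduce : ∀ i → i + i + 1ℤ + θ a (j - i - 1ℤ) ≈ j + i [mod d ]
      reduce i = ≈-trans (≈-+ (≈-reflexive {i = i + i + 1ℤ} refl) (θ-≈ a (j - i - 1ℤ))) (≈-reflexive (identity i j))
      i≈i′ : i ≈ i′ [mod d ]
      i≈i′ = ≈-cancelˡ j (≈-trans (≈-sym (reduce i)) (≈-trans (≈-coarsen d∣D p) (reduce i′)))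
      same : θ a s ≡ θ a s′
      same = θ-cong a (≈-+ (≈-+ (≈-reflexive {i = j} refl) (≈-neg i≈i′)) (≈-reflexive {i = - 1ℤ} refl))
      rearrange : ∀ i x → i + i + 1ℤ + x ≡ (1ℤ + x) + (i + i)
      rearrange = solve-∀
      2i≈2i′ : i + i ≈ i′ + i′ [mod D ]
      2i≈2i′ = ≈-cancelˡ (1ℤ + θ a s) (≈-trans (≈-reflexive (sym (rearrange i (θ a s))))
        (≈-trans p (≈-reflexive (trans (cong (λ x → i′ + i′ + 1ℤ + x) (sym same)) (rearrange i′ (θ a s))))))

  -- Lists: indexing with a default, and concatenations without repetition.

  module _ {A : Set} where

    -- Past the end the value is z: with the head of a cycle for z, the index
    -- length xs wraps around.
    at : A → List A → ℕ → A
    at z []       _       = z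
    at z (x ∷ xs) zero    = x
    at z (x ∷ xs) (suc k) = at z xs k

    -- The appended element is the default, which `at` returns at that index anyway.
    at-∷ʳ : ∀ x xs k → at x (xs ∷ʳ x) k ≡ at x xs k
    at-∷ʳ x []       zero    = refl
    at-∷ʳ x []       (suc k) = refl
    at-∷ʳ x (y ∷ xs) zero    = refl
    at-∷ʳ x (y ∷ xs) (suc k) = at-∷ʳ x xs k

    at-map : ∀ (f : A → A) z xs {k} → k < length xs → at z (map f xs) k ≡ f (at z xs k)
    at-map f z (x ∷ xs) {zero}  _         = refl
    at-map f z (x ∷ xs) {suc k} (s≤s k<n) = at-map f z xs k<n

    at-length : ∀ z xs → at z xs (length xs) ≡ z
    at-length z []       = refl
    at-length z (x ∷ xs) = at-length z xs

    at-∈ : ∀ z xs {k} → k < length xs → at z xs k ∈ xs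
    at-∈ z (x ∷ xs) {zero}  _         = here refl
    at-∈ z (x ∷ xs) {suc k} (s≤s k<n) = there (at-∈ z xs k<n)

    at-onto : ∀ z {xs y} → y ∈ xs → ∃[ k ] k < length xs × at z xs k ≡ y
    at-onto z (here refl) = 0 , s≤s z≤n , refl
    at-onto z (there p) with k , k<n , eq ← at-onto z p = suc k , s≤s k<n , eq

    at-injective : ∀ z {xs} → Unique xs → ∀ {j k} → j < length xs → k < length xs →
                   at z xs j ≡ at z xs k → j ≡ k
    at-injective z {x ∷ xs} (x∉ ∷ u) {zero}  {zero}  _ _ _ = refl
    at-injective z {x ∷ xs} (x∉ ∷ u) {zero}  {suc k} _ (s≤s k<n) eq =
      contradiction eq (All.lookup x∉ (at-∈ z xs k<n))
    at-injective z {x ∷ xs} (x∉ ∷ u) {suc j} {zero}  (s≤s j<n) _ eq =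
      contradiction (sym eq) (All.lookup x∉ (at-∈ z xs j<n))
    at-injective z {x ∷ xs} (x∉ ∷ u) {suc j} {suc k} (s≤s j<n) (s≤s k<n) eq =
      cong suc (at-injective z u j<n k<n eq)

    Unique-++⁻ : ∀ xs {ys : List A} → Unique (xs ++ ys) → Unique xs × Unique ys × (∀ {y} → y ∈ xs → y ∈ ys → ⊥)
    Unique-++⁻ []       u        = [] , u , λ ()
    Unique-++⁻ (x ∷ xs) (x∉ ∷ u) with Unique-++⁻ xs u
    ... | uxs , uys , disjoint = ++⁻ˡ xs x∉ ∷ uxs , uys ,
      λ { (here refl) y∈ys → All.lookup (++⁻ʳ xs x∉) y∈ys refl ; (there y∈xs) → disjoint y∈xs }

    Unique-concat⇒Unique : ∀ (xss : List (List A)) → Unique (concat xss) → ∀ a → Unique (lookup xss a)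
    Unique-concat⇒Unique (xs ∷ xss) u zero    = proj₁ (Unique-++⁻ xs u)
    Unique-concat⇒Unique (xs ∷ xss) u (suc a) = Unique-concat⇒Unique xss (proj₁ (proj₂ (Unique-++⁻ xs u))) a

    Unique-concat⇒index-unique : ∀ (xss : List (List A)) → Unique (concat xss) → ∀ a b {y} →
                                 y ∈ lookup xss a → y ∈ lookup xss b → a ≡ b
    Unique-concat⇒index-unique (xs ∷ xss) u zero zero p q = refl
    Unique-concat⇒index-unique (xs ∷ xss) u zero (suc b) p q =
      contradiction (∈-concat⁺′ q (∈-lookup {xs = xss} b)) (proj₂ (proj₂ (Unique-++⁻ xs u)) p)
    Unique-concat⇒index-unique (xs ∷ xss) u (suc a) zero p q =
      contradiction (∈-concat⁺′ p (∈-lookup {xs = xss} a)) (proj₂ (proj₂ (Unique-++⁻ xs u)) q)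
    Unique-concat⇒index-unique (xs ∷ xss) u (suc a) (suc b) p q =
      cong suc (Unique-concat⇒index-unique xss (proj₁ (proj₂ (Unique-++⁻ xs u))) a b p q)

    -- Cycle lengths are prescribed only up to order; this allows the cycles to be rearranged with
    -- the long one first.
    concat-↭ : {xss yss : List (List A)} → xss ↭ yss → concat xss ↭ concat yss
    concat-↭ ↭.refl           = ↭.refl
    concat-↭ (↭.prep xs p)    = ++⁺ˡ xs (concat-↭ p)
    concat-↭ (↭.swap xs ys p) = ↭-trans (shifts xs ys) (++⁺ˡ ys (++⁺ˡ xs (concat-↭ p)))
    concat-↭ (↭.trans p q)    = ↭-trans (concat-↭ p) (concat-↭ q)

    map≡replicate : ∀ {B : Set} (f : A → B) {y} l xs → map f xs ≡ replicate l y →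
                    length xs ≡ l × All (λ x → f x ≡ y) xs
    map≡replicate f zero    []       eq = refl , []
    map≡replicate f (suc l) (x ∷ xs) eq with map≡replicate f l xs (cong (λ { [] → [] ; (_ ∷ ys) → ys }) eq)
    ... | len , all = cong suc len , cong (λ { [] → f x ; (y ∷ _) → y }) eq ∷ all

  -- Labelling the points along the cycles of `β`.

  record Enumeration {n} (β : Permutation′ n) (N : ℕ) (c : List (Fin n)) : Set where
    field
      walk           : ℤ → Fin n
      walk-step      : ∀ i → β ⟨$⟩ʳ walk i ≡ walk (1ℤ + i)
      walk-∈         : ∀ i → walk i ∈ c
      walk-cong      : ∀ {i j} → i ≈ j [mod N ] → walk i ≡ walk j
      walk-onto      : ∀ {y} → y ∈ c → ∃[ i ] walk i ≡ y
      -- A list satisfying `IsCycle` may run round its cycle several times, so distinctness is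
      -- assumed separately.
      walk-injective : Unique c → ∀ {i j} → walk i ≡ walk j → i ≈ j [mod N ]

  enumerate : ∀ {n} {β : Permutation′ n} {c} → IsCycle β c → Enumeration β (length c) c
  enumerate {n} {β} (cycle {x} {xs} eq) = record
    { walk           = walk
    ; walk-step      = step
    ; walk-∈         = λ i → at-∈ x c (n%ℕd<d i N)
    ; walk-cong      = λ p → cong (at x c) (≈⇒%≡ N p)
    ; walk-onto      = onto
    ; walk-injective = λ u {i} {j} e → %≡⇒≈ N (at-injective x u (n%ℕd<d i N) (n%ℕd<d j N) e)
    }
    where
    c = x ∷ xs
    N = length c
    walk : ℤ → Fin n
    walk i = at x c (i %ℕ N)
    at-step : ∀ {k} → k < N → β ⟨$⟩ʳ at x c k ≡ at x c (suc k)
    -- Entry k of `xs ∷ʳ x` is entry k + 1 of `c`, with the default `x` after the end.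
    at-step {k} k<N = trans (sym (at-map (β ⟨$⟩ʳ_) x c k<N))
                        (trans (cong (λ ys → at x ys k) eq) (at-∷ʳ x xs k))
    wrap : ∀ {k} i → k < N → + k ≈ i [mod N ] → at x c (suc k) ≡ walk (1ℤ + i)
    wrap {k} i k<N p with suc k <? N
    ... | yes k+1<N = cong (at x c) (+-≈⇒≡ k+1<N (n%ℕd<d (1ℤ + i) N)
                        (≈-trans (≈-+ (≈-reflexive {i = 1ℤ} refl) p) (≈-sym (%-≈ (1ℤ + i) N))))
    -- At the end of the list `at` returns its default, the head of the cycle, which is also entry
    -- 0; and 1 + i ≡ N ≡ 0.
    ... | no  k+1≮N = trans (cong (at x c) k+1≡N) (trans (at-length x c) (cong (at x c) 0≡))
      where
      k+1≡N : suc k ≡ N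
      k+1≡N = ℕ.≤-antisym k<N (ℕ.≮⇒≥ k+1≮N)
      N≈0 : + 0 ≈ + N [mod N ]
      N≈0 = ≈-sym (mod (divides 1ℤ (trans (ℤ.+-identityʳ (+ N)) (sym (ℤ.*-identityˡ (+ N))))))
      0≡ : 0 ≡ (1ℤ + i) %ℕ N
      0≡ = +-≈⇒≡ (s≤s z≤n) (n%ℕd<d (1ℤ + i) N)
             (≈-trans N≈0 (≈-trans (≈-reflexive (cong +_ (sym k+1≡N)))
               (≈-trans (≈-+ (≈-reflexive {i = 1ℤ} refl) p) (≈-sym (%-≈ (1ℤ + i) N)))))
    step : ∀ i → β ⟨$⟩ʳ walk i ≡ walk (1ℤ + i)
    step i = trans (at-step (n%ℕd<d i N)) (wrap i (n%ℕd<d i N) (%-≈ i N))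
    onto : ∀ {y} → y ∈ c → ∃[ i ] walk i ≡ y
    onto y∈c with k , k<N , e ← at-onto x y∈c = + k , trans (cong (at x c) (ℕ.m<n⇒m%n≡m k<N)) e

  -- A bijection between `Fin n` and labels modulo `Same`. `encode` merely picks a representative,
  -- so it need not commute with `shift` exactly.
  record Coordinates {n} (β : Permutation′ n) (D d l : ℕ) : Set where
    field
      decode           : Point l → Fin n
      decode-step      : ∀ c → β ⟨$⟩ʳ decode c ≡ decode (shift 1ℤ c)
      decode-cong      : ∀ {c c′} → Same D d c c′ → decode c ≡ decode c′
      decode-injective : ∀ {c c′} → decode c ≡ decode c′ → Same D d c c′
      encode           : Fin n → Point l
      decode-encode    : ∀ x → decode (encode x) ≡ x

  coordinates : ∀ {n} {β : Permutation′ n} {D d l} → HasCycleStructure β (D ∷ replicate l d) → Coordinates β D d l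
  coordinates {n} {β} {D} {d} {l} (cycles , areCycles , covers , lengths)
    -- The permutation of the lengths is pulled back to one of the cycles themselves.
    with ↭-map-inv length lengths
  ... | c₀ ∷ cs , eq , ρ
    with refl ← cong (λ { [] → D ; (k ∷ _) → k }) eq
    with refl , len ← map≡replicate length l cs (sym (cong (λ { [] → [] ; (_ ∷ ks) → ks }) eq))
    with isCycle₀ ∷ areCycles₁ ← All-resp-↭ ρ areCycles
    = record
    { decode           = decode
    ; decode-step      = step
    ; decode-cong      = decode-cong
    ; decode-injective = inj
    ; encode           = λ x → proj₁ (onto x)
    ; decode-encode    = λ x → proj₂ (onto x)
    }
    where
    open Enumeration
    all↭ : concat (c₀ ∷ cs) ↭ allFin n
    all↭ = ↭-trans (↭-sym (concat-↭ ρ)) covers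
    unique : Unique (concat (c₀ ∷ cs))
    unique = Unique-resp-↭ (setoid (Fin n)) (↭⇒↭ₛ (↭-sym all↭)) (allFin⁺ n)
    E₀ : Enumeration β D c₀
    E₀ = enumerate isCycle₀
    E : ∀ a → Enumeration β d (lookup cs a)
    E a = subst (λ N → Enumeration β N (lookup cs a)) (All.lookup len (∈-lookup a))
            (enumerate (All.lookup areCycles₁ (∈-lookup a)))
    decode : Point l → Fin n
    decode (big i)     = walk E₀ i
    decode (small a i) = walk (E a) i
    step : ∀ c → β ⟨$⟩ʳ decode c ≡ decode (shift 1ℤ c)
    step (big i)     = walk-step E₀ i
    step (small a i) = walk-step (E a) i
    decode-cong : ∀ {c c′} → Same D d c c′ → decode c ≡ decode c′
    decode-cong (big p)          = walk-cong E₀ p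
    decode-cong (small {a} refl p) = walk-cong (E a) p
    index : Point l → Fin (suc l)
    index (big _)     = zero
    index (small a _) = suc a
    decode-∈ : ∀ c → decode c ∈ lookup (c₀ ∷ cs) (index c)
    decode-∈ (big i)     = walk-∈ E₀ i
    decode-∈ (small a i) = walk-∈ (E a) i
    index-unique : ∀ c c′ → decode c ≡ decode c′ → index c ≡ index c′
    index-unique c c′ e = Unique-concat⇒index-unique (c₀ ∷ cs) unique (index c) (index c′) (decode-∈ c)
      (subst (_∈ lookup (c₀ ∷ cs) (index c′)) (sym e) (decode-∈ c′))
    inj : ∀ {c c′} → decode c ≡ decode c′ → Same D d c c′
    inj {c} {c′} e with index-unique c c′ e
    inj {big i}     {big j}      e | _    =
      big (walk-injective E₀ (Unique-concat⇒Unique (c₀ ∷ cs) unique zero) e)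
    inj {small a i} {small .a j} e | refl =
      small refl (walk-injective (E a) (Unique-concat⇒Unique (c₀ ∷ cs) unique (suc a)) e)
    onto : ∀ x → ∃[ c ] decode c ≡ x
    onto x with ∈-concat⁻ (c₀ ∷ cs) (∈-resp-↭ (↭-sym all↭) (∈-allFin x))
    ... | here p with i , e ← walk-onto E₀ p = big i , e
    ... | there q with i , e ← walk-onto (E (Any.index q)) (lookup-index q) = small (Any.index q) i , e

  -- Autoparatopisms and the twist identity.

  injective⇒surjective : ∀ {n} {f : Fin n → Fin n} → Injective _≡_ _≡_ f → ∀ z → ∃[ x ] f x ≡ z
  injective⇒surjective {suc n} {f} inj z with any? (λ x → f x Fin.≟ z)
  ... | yes hit = hit
  -- Pigeonhole: punching the missed `z` out of the codomain would inject `Fin (suc n)` into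
  -- `Fin n`.
  ... | no miss = contradiction
    (injective⇒≤ {f = λ x → punchOut (avoid x)} (λ e → inj (punchOut-injective (avoid _) (avoid _) e)))
    ℕ.1+n≰n
    where
    avoid : ∀ x → z ≢ f x
    avoid x e = miss (x , sym e)

  module _ {n : ℕ} (β : Permutation′ n) where

    β-injective : ∀ {x y} → β ⟨$⟩ʳ x ≡ β ⟨$⟩ʳ y → x ≡ y
    β-injective = Injection.injective (↔⇒↣ β)

    Twisted : (Fin n → Fin n → Fin n) → Set
    Twisted _·_ = ∀ x y → (β ⟨$⟩ʳ y) · x ≡ β ⟨$⟩ʳ (x · y)

    autoparatopism⇒twisted : ∀ L → IsAutoparatopism ⟨ id , β , β ⨾ [12] ⟩ L → Twisted (LatinSquare.entry L)
    autoparatopism⇒twisted L (moved , _) x y = moved {t′} (t , refl , λ { 0F → refl ; 1F → refl ; 2F → refl })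
      where
      t t′ : Triple n
      t 0F = x
      t 1F = y
      t 2F = LatinSquare.entry L x y
      t′ 0F = β ⟨$⟩ʳ y
      t′ 1F = x
      t′ 2F = β ⟨$⟩ʳ LatinSquare.entry L x y

    twisted⇒autoparatopism : ∀ L → Twisted (LatinSquare.entry L) → IsAutoparatopism ⟨ id , β , β ⨾ [12] ⟩ L
    twisted⇒autoparatopism L twisted = (λ {t′} → into {t′}) , λ {t′} → onto {t′}
      where
      open LatinSquare L
      into : (O L ^ ⟨ id , β , β ⨾ [12] ⟩) ⊆ O L
      into {t′} (t , t∈L , moves) = trans (cong₂ entry (moves 1F) (moves 0F))
        (trans (twisted (t 0F) (t 1F)) (trans (cong (β ⟨$⟩ʳ_) t∈L) (sym (moves 2F))))
      onto : O L ⊆ (O L ^ ⟨ id , β , β ⨾ [12] ⟩)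
      onto {t′} t′∈L = t , β-injective t∈L ,
        λ { 0F → refl ; 1F → sym (inverseʳ β) ; 2F → sym (inverseʳ β) }
        where
        t : Triple n
        -- The only possible preimage of (x′ , y′ , z′) is (y′ , x′ β⁻¹ , z′ β⁻¹).
        t 0F = t′ 1F
        t 1F = β ⟨$⟩ˡ t′ 0F
        t 2F = β ⟨$⟩ˡ t′ 2F
        t∈L : β ⟨$⟩ʳ entry (t 0F) (t 1F) ≡ β ⟨$⟩ʳ t 2F
        t∈L = trans (sym (twisted (t 0F) (t 1F)))
          (trans (cong (λ x → entry x (t′ 1F)) (inverseʳ β)) (trans t′∈L (sym (inverseʳ β))))

    -- Column x is the image under β of row x with its cells permuted by β.
    twisted⇒Par : (_·_ : Fin n → Fin n → Fin n) → Twisted _·_ → (∀ x {y z} → x · y ≡ x · z → y ≡ z) →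
                  Par n ⟨ id , β , β ⨾ [12] ⟩
    twisted⇒Par _·_ twisted cancelˡ = L , twisted⇒autoparatopism L twisted
      where
      cancelʳ : ∀ y {x z} → x · y ≡ z · y → x ≡ z
      cancelʳ y {x} {z} e = trans (sym (inverseʳ β)) (trans (cong (β ⟨$⟩ʳ_) (cancelˡ y (β-injective
        (trans (unfold x) (trans e (sym (unfold z))))))) (inverseʳ β))
        where
        unfold : ∀ x → β ⟨$⟩ʳ (y · (β ⟨$⟩ˡ x)) ≡ x · y
        unfold x = trans (sym (twisted y (β ⟨$⟩ˡ x))) (cong (_· y) (inverseʳ β))
      L : LatinSquare n
      L = record
        { entry  = _·_
        ; row    = λ x z → let y , e = injective⇒surjective (cancelˡ x) z in
                           y , e , λ e′ → cancelˡ x (trans e (sym e′))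
        ; column = λ y z → let x , e = injective⇒surjective (cancelʳ y) z in
                           x , e , λ e′ → cancelʳ y (trans e (sym e′))
        }

  -- Sufficiency: the product carried over from labels to `Fin n`.

  module _ {n m h l : ℕ} {{_ : NonZero m}} {{_ : NonZero h}} {β : Permutation′ n}
           (C : Coordinates β (m ℕ.* (h ℕ.+ h)) (h ℕ.+ h) l) where
    open Coordinates C

    l≤m⇒Par : ¬ (2 ℕ.∣ m) → l ≤ m → Par n ⟨ id , β , β ⨾ [12] ⟩
    l≤m⇒Par 2∤m l≤m = twisted⇒Par β _·_ twisted cancelˡ
      where
      open Square m h l 2∤m l≤m
      _·_ : Fin n → Fin n → Fin n
      x · y = decode (encode x ∙ encode y)
      twisted : Twisted β _·_
      twisted x y = begin
        decode (encode (β ⟨$⟩ʳ y) ∙ encode x)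
          ≡⟨ decode-cong (∙-congˡ (encode x) (decode-injective encode-step)) ⟩
        decode (shift 1ℤ (encode y) ∙ encode x)        ≡⟨ cong decode (∙-twist (encode x) (encode y)) ⟩
        decode (shift 1ℤ (encode x ∙ encode y))        ≡⟨ decode-step (encode x ∙ encode y) ⟨
        β ⟨$⟩ʳ decode (encode x ∙ encode y)            ∎
        where
        open ≡-Reasoning
        encode-step : decode (encode (β ⟨$⟩ʳ y)) ≡ decode (shift 1ℤ (encode y))
        encode-step = trans (decode-encode _) (trans (cong (β ⟨$⟩ʳ_) (sym (decode-encode y))) (decode-step (encode y)))
      cancelˡ : ∀ x {y z} → x · y ≡ x · z → y ≡ z
      cancelˡ x {y} {z} e = trans (sym (decode-encode y))
        (trans (decode-cong (∙-cancelˡ (encode x) (decode-injective e))) (decode-encode z))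

  -- Necessity: counting in a row indexed by the long cycle.

  module _ {n m d l : ℕ} {{_ : NonZero m}} {{_ : NonZero d}} {β : Permutation′ n}
           (C : Coordinates β (m ℕ.* d) d l) where
    open Coordinates C

    private
      D = m ℕ.* d
      instance
        D≢0 : NonZero D
        D≢0 = ℕ.m*n≢0 m d

    Par⇒l≤m : (1 ≤ l → D ≢ d) → Par n ⟨ id , β , β ⨾ [12] ⟩ → l ≤ m
    Par⇒l≤m D≢d (L , auto) = ℕ.*-cancelʳ-≤ l m d (injective⇒≤ {f = position} position-injective)
      where
      open LatinSquare L
      twisted = autoparatopism⇒twisted β L auto

      -- One use of the twist identity swaps the factors and a second restores their order, so
      -- shifting both factors by 1 shifts the product by 2.
      entry-shift : ∀ k x y z → entry (decode x) (decode y) ≡ decode z →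
                    entry (decode (shift (+ k) x)) (decode (shift (+ k) y)) ≡ decode (shift (+ k + + k) z)
      entry-shift zero x y z e = trans
        (cong₂ entry (cong decode (shift-0 x)) (cong decode (shift-0 y)))
        (trans e (cong decode (sym (shift-0 z))))
        where
        shift-0 : ∀ (c : Point l) → shift (+ 0) c ≡ c
        shift-0 (big i)     = cong big (ℤ.+-identityˡ i)
        shift-0 (small a i) = cong (small a) (ℤ.+-identityˡ i)
      entry-shift (suc k) x y z e = begin
        entry (decode (shift (+ suc k) x)) (decode (shift (+ suc k) y)) ≡⟨ cong₂ entry (step x) (step y) ⟩
        entry (β ⟨$⟩ʳ x′) (β ⟨$⟩ʳ y′)                                   ≡⟨ twisted (β ⟨$⟩ʳ y′) x′ ⟩
        β ⟨$⟩ʳ entry (β ⟨$⟩ʳ y′) x′                                     ≡⟨ cong (β ⟨$⟩ʳ_) (twisted x′ y′) ⟩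
        β ⟨$⟩ʳ (β ⟨$⟩ʳ entry x′ y′)
          ≡⟨ cong (λ w → β ⟨$⟩ʳ (β ⟨$⟩ʳ w)) (entry-shift k x y z e) ⟩
        β ⟨$⟩ʳ (β ⟨$⟩ʳ decode z′)                                       ≡⟨ cong (β ⟨$⟩ʳ_) (decode-step z′) ⟩
        β ⟨$⟩ʳ decode (shift 1ℤ z′)                                     ≡⟨ decode-step (shift 1ℤ z′) ⟩
        decode (shift 1ℤ (shift 1ℤ z′))
          ≡⟨ cong decode (trans (cong (shift 1ℤ) (shift-shift 1ℤ _ z)) (shift-shift 1ℤ _ z)) ⟩
        decode (shift (1ℤ + (1ℤ + (+ k + + k))) z)
          ≡⟨ cong (λ i → decode (shift i z)) (identity (+ k)) ⟩
        decode (shift (+ suc k + + suc k) z)                            ∎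
        where
        open ≡-Reasoning
        x′ = decode (shift (+ k) x)
        y′ = decode (shift (+ k) y)
        z′ = shift (+ k + + k) z
        step : ∀ c → decode (shift (+ suc k) c) ≡ β ⟨$⟩ʳ decode (shift (+ k) c)
        step c = trans (cong decode (sym (shift-shift 1ℤ (+ k) c))) (sym (decode-step (shift (+ k) c)))
        identity : ∀ k → 1ℤ + (1ℤ + (k + k)) ≡ (1ℤ + k) + (1ℤ + k)
        identity = solve-∀

      x₀ = decode (big 0ℤ)

      shift-period : ∀ i j → + d ∣ i → i + j ≈ j [mod d ]
      shift-period i j p = mod (subst (+ d ∣_) (identity i j) p)
        where
        identity : ∀ i j → i ≡ i + j - j
        identity = solve-∀

      entry-not-small : ∀ a j b k → entry x₀ (decode (small a j)) ≢ decode (small b k)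
      -- The index `a` witnesses 1 ≤ l. As `d` divides `D = m * d`, only the converse divisibility
      -- is left to refute.
      entry-not-small a j b k e = D≢d (ℕ.≤-trans (s≤s z≤n) (toℕ<n a)) (ℕ.∣-antisym D∣d (ℕ.divides m refl))
        where
        y = decode (small a j)
        d∣d : + d ∣ + d
        d∣d = divides 1ℤ (sym (ℤ.*-identityˡ (+ d)))
        moved : entry (decode (big (+ d + 0ℤ))) y ≡ entry x₀ y
        moved = begin
          entry (decode (big (+ d + 0ℤ))) y
            ≡⟨ cong (entry _) (decode-cong (small refl (shift-period (+ d) j d∣d))) ⟨
          entry (decode (big (+ d + 0ℤ))) (decode (small a (+ d + j)))
            ≡⟨ entry-shift d (big 0ℤ) (small a j) (small b k) e ⟩
          decode (small b (+ d + + d + k))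
            ≡⟨ decode-cong (small refl (shift-period (+ d + + d) k (∣m∣n⇒∣m+n d∣d d∣d))) ⟩
          decode (small b k)                                      ≡⟨ e ⟨
          entry x₀ y                                              ∎
          where open ≡-Reasoning
        fixed : decode (big (+ d + 0ℤ)) ≡ x₀
        -- `x₀` and its image under βᵈ solve the same equation in column `y`, hence coincide.
        fixed with _ , _ , unique ← column y (entry x₀ y) = trans (sym (unique moved)) (unique refl)
        D∣d : D ℕ.∣ d
        D∣d with big (mod p) ← decode-injective fixed =
          ∣⇒∣ᵤ (subst (+ D ∣_) (trans (ℤ.+-identityʳ (+ d + 0ℤ)) (ℤ.+-identityʳ (+ d))) p)

      entry-big : ∀ a j → ∃[ i ] entry x₀ (decode (small a j)) ≡ decode (big i)
      entry-big a j with encode (entry x₀ (decode (small a j))) in e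
      ... | big i     = i , trans (sym (decode-encode _)) (cong decode e)
      ... | small b k = contradiction (trans (sym (decode-encode _)) (cong decode e)) (entry-not-small a j b k)

      -- Labels of a long point are not unique, so the one found is reduced modulo `D`.
      place : Fin l × Fin d → Fin D
      place (a , j) = fromℕ< (n%ℕd<d (proj₁ (entry-big a (+ toℕ j))) D)

      place-injective : ∀ {p q} → place p ≡ place q → p ≡ q
      place-injective {a , j} {b , k} e
        with i , eᵢ ← entry-big a (+ toℕ j) | i′ , eᵢ′ ← entry-big b (+ toℕ k)
        -- Equal residues give both short points the same image in row `x₀`, and `unique` is
        -- uniqueness along that row.
        = finish (decode-injective (trans (sym (unique refl)) (unique (trans eᵢ′ (trans (sym same) (sym eᵢ))))))
        where
        unique = proj₂ (proj₂ (row x₀ (entry x₀ (decode (small a (+ toℕ j))))))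
        same : decode (big i) ≡ decode (big i′)
        same = decode-cong (big (%≡⇒≈ D (fromℕ<-injective _ _ (n%ℕd<d i D) (n%ℕd<d i′ D) e)))
        finish : Same D d (small a (+ toℕ j)) (small b (+ toℕ k)) → (a , j) ≡ (b , k)
        finish (small refl p) = cong (a ,_) (toℕ-injective (+-≈⇒≡ (toℕ<n j) (toℕ<n k) p))

      position : Fin (l ℕ.* d) → Fin D
      position = place ∘ remQuot {l} d

      position-injective : Injective _≡_ _≡_ position
      position-injective {i} {j} e = trans (sym (combine-remQuot {l} d i))
        (trans (cong (λ p → combine (proj₁ p) (proj₂ p)) (place-injective e)) (combine-remQuot {l} d j))

-- From `d₁` and `d₂` to `m` and `h`, and the two implications.

open import Data.Fin.Permutation using (Permutation′; id)
open import Data.List using (_∷_; replicate)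
open import Data.Nat using (ℕ; _+_; _*_; _≤_; _/_; NonZero; ≢-nonZero; ≢-nonZero⁻¹)
open import Data.Nat.Divisibility using (_∣_; divides; _∣0)
open import Data.Nat.DivMod using (m*n/n≡m)
open import Data.Nat.Primality using (euclidsLemma; prime[2])
open import Data.Nat.Properties using (*-comm; +-identityʳ)
open import Data.Sum using (inj₁; inj₂)
open import Function.Bundles using (_⇔_; mk⇔)
open import Relation.Binary.PropositionalEquality using (_≡_; _≢_; refl; trans; cong)
open import Relation.Nullary using (¬_; contradiction)
open import Relation.Unary using (_∈_)
open TwistedProducts using (Coordinates; coordinates; Par⇒l≤m; l≤m⇒Par)

theorem4p16 : ∀ (d₁ d₂ : ℕ) .{{_ : NonZero d₁}} .{{_ : NonZero d₂}} →
    2 ∣ d₁ → d₂ ∣ d₁ → ¬ (2 ∣ d₁ / d₂) →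
    ∀ (l n : ℕ) → n ≡ d₁ + l * d₂ →
    (1 ≤ l → d₁ ≢ d₂) →
    ∀ (β : Permutation′ n) → HasCycleStructure β (d₁ ∷ replicate l d₂) →
    ⟨ id , β , β ⨾ [12] ⟩ ∈ Par n ⇔ l ≤ d₁ / d₂
theorem4p16 d₁ d₂ {{_}} {{d₂≢0}} 2∣d₁ (divides m refl) 2∤d₁/d₂ l n _ d₁≢d₂ β structure
  rewrite m*n/n≡m m d₂ {{d₂≢0}}
  -- Here `d₁ = m * d₂` is even and `m` is odd, so `d₂` is even and supplies `h`.
  with euclidsLemma m d₂ prime[2] 2∣d₁
... | inj₁ 2∣m = contradiction 2∣m 2∤d₁/d₂
... | inj₂ (divides h eq)
  -- Replaces `d₂` by `h + h`, the form in which the construction takes the short length.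
  with refl ← trans eq (trans (*-comm h 2) (cong (h +_) (+-identityʳ h)))
  = mk⇔ (Par⇒l≤m {{m≢0}} {{d≢0}} C d₁≢d₂) (l≤m⇒Par {{m≢0}} {{h≢0}} C 2∤d₁/d₂)
  where
  C : Coordinates β (m * (h + h)) (h + h) l
  C = coordinates structure
  d≢0 : NonZero (h + h)
  d≢0 = ≢-nonZero (≢-nonZero⁻¹ (h + h))
  h≢0 : NonZero h
  h≢0 = ≢-nonZero λ { refl → ≢-nonZero⁻¹ 0 refl }
  m≢0 : NonZero m
  m≢0 = ≢-nonZero λ { refl → 2∤d₁/d₂ (2 ∣0) }
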